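{- There exist decidable equivalence relations $F$ and $G$ on $\mathbb{N}$ such that $F \vee G$ is a semi-decidable FC equivalence relation that is not decidable, and $F \vee G = FGF$.
   Context: $\mathbb{N}=\{0,1,2,\dots\}$. Relations are subsets of $\mathbb{N}\times\mathbb{N}$. "Decidable" means recursive; "semi-decidable" means recursively enumerable. An equivalence relation on $\mathbb{N}$ is called FC if every one of its equivalence classes is finite. The composition of binary relations is $RS=\{(x,z) : \exists y\, [(x,y)\in R \text{ and } (y,z)\in S]\}$. $F\vee G$ denotes the join in the lattice of equivalence relations, i.e. the transitive closure of $F\cup G$. -}

module Defs where

open import Axiom.DoubleNegationElimination using (em⇒dne)
open import Axiom.ExcludedMiddle using (ExcludedMiddle)
open import Data.Fin.Base using (Fin)
open import Data.List.Base using (List)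
open import Data.List.Membership.Propositional using (_∈_)
open import Data.Nat.Base using (ℕ; zero; suc; _<_)
open import Data.Product.Base using (∃; _×_)
open import Data.Sum.Base using (_⊎_)
open import Data.Vec.Base using (Vec; []; _∷_; lookup)
open import Data.Vec.Relation.Binary.Pointwise.Inductive using (Pointwise)
open import Function.Bundles using (_⇔_)
open import Level using (0ℓ)
open import Relation.Binary.Construct.Closure.Transitive using (TransClosure)
open import Relation.Binary.Construct.Composition public
  using () renaming (_;_ to _⨾_)
open import Relation.Binary.Construct.Union using (_∪_)
open import Relation.Binary.Core using (Rel)
open import Relation.Nullary.Negation.Core using (¬_)
open import Relation.Unary using (Pred; _≐_)

-- Kleene's schemes for the partial recursive functions ℕⁿ ⇀ ℕ.

data PartialRec : ℕ → Set where
  zeroᶠ : PartialRec 0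
  sucᶠ  : PartialRec 1
  proj  : ∀ {n} → Fin n → PartialRec n
  comp  : ∀ {m n} → PartialRec m → Vec (PartialRec n) m → PartialRec n
  prec  : ∀ {n} → PartialRec n → PartialRec (suc (suc n)) → PartialRec (suc n)
  μ     : ∀ {n} → PartialRec (suc n) → PartialRec n

-- f [ xs ]↓ z : the partial function f is defined at xs, with value z.

infix 4 _[_]↓_

data _[_]↓_ : ∀ {n} → PartialRec n → Vec ℕ n → ℕ → Set where
  ↓zero : zeroᶠ [ [] ]↓ 0
  ↓suc  : ∀ {x} → sucᶠ [ x ∷ [] ]↓ suc x
  ↓proj : ∀ {n} {i : Fin n} {xs} → proj i [ xs ]↓ lookup xs i
  ↓comp : ∀ {m n} {f : PartialRec m} {gs : Vec (PartialRec n) m} {xs ys z} →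
          Pointwise (λ g y → g [ xs ]↓ y) gs ys →
          f [ ys ]↓ z →
          comp f gs [ xs ]↓ z
  ↓prec-zero : ∀ {n} {f : PartialRec n} {g xs z} →
          f [ xs ]↓ z →
          prec f g [ zero ∷ xs ]↓ z
  ↓prec-suc  : ∀ {n} {f : PartialRec n} {g xs k r z} →
          prec f g [ k ∷ xs ]↓ r →
          g [ k ∷ r ∷ xs ]↓ z →
          prec f g [ suc k ∷ xs ]↓ z
  -- Minimisation requires f to be defined (and nonzero) below the root.
  ↓μ    : ∀ {n} {f : PartialRec (suc n)} {xs y} →
          f [ y ∷ xs ]↓ 0 →
          (∀ {i} → i < y → ∃ λ k → f [ i ∷ xs ]↓ suc k) →
          μ f [ xs ]↓ y

-- The characteristic function of R is a (total) recursive function.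

Recursive : Rel ℕ 0ℓ → Set
Recursive R = ∃ λ (χ : PartialRec 2) → ∀ x y →
  (R x y × χ [ x ∷ y ∷ [] ]↓ 1) ⊎ (¬ R x y × χ [ x ∷ y ∷ [] ]↓ 0)

-- R is the domain of a partial recursive function.

RecursivelyEnumerable : Rel ℕ 0ℓ → Set
RecursivelyEnumerable R = ∃ λ (f : PartialRec 2) → ∀ x y →
  R x y ⇔ ∃ λ z → f [ x ∷ y ∷ [] ]↓ z

Finite : Pred ℕ 0ℓ → Set
Finite P = ∃ λ (xs : List ℕ) → P ≐ (_∈ xs)

-- The ¬ ¬ makes finiteness of the classes classical: under excluded
-- middle it disappears (em⇒FC-finite).  Without it, testing y ∈ xs for the
-- given list xs of the class of x would decide R x y, so that, under
-- Church's thesis, every FC relation would be recursive.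

FC : Rel ℕ 0ℓ → Set
FC R = ∀ x → ¬ ¬ Finite (R x)

em⇒FC-finite : ExcludedMiddle 0ℓ → ∀ {R} → FC R → ∀ x → Finite (R x)
em⇒FC-finite em fc x = em⇒dne em (fc x)

infixr 6 _∨_

_∨_ : Rel ℕ 0ℓ → Rel ℕ 0ℓ → Rel ℕ 0ℓ
F ∨ G = TransClosure (F ∪ G)

{-# OPTIONS --safe #-}
module Submission where

-- Let points be pairs (u , i) with u = (e , t).  F merges the rows u = (e , t)
-- and (e , 0), columnwise, whenever program e run on its own code outputs 0 at
-- time t exactly; for such u, G identifies (u , 0) with (u , 1).  Both are
-- decidable, but ((e , 0) , 0) and ((e , 0) , 1) are joined precisely when e
-- outputs 0 on itself, and then by an FGF path.  Classes are finite because
-- there is at most one such t.  A decision procedure for F ∨ G would yield a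
-- program d that outputs 1 on e if e outputs 0 on itself, and 0 otherwise;
-- running d on itself is contradictory.  For this, the interpreter
-- need only be deterministic and reproduce every value of every program: what
-- it does on a divergent program does not matter.

open import Defs
open import Data.Empty using (⊥)
open import Data.Fin.Base using (Fin; zero; suc)
open import Data.Fin.Patterns using (0F; 1F; 2F; 3F)
open import Data.List.Base using ([]; _∷_; cartesianProductWith)
open import Data.List.Membership.Propositional using (_∈_)
open import Data.List.Membership.Propositional.Properties
  using (∈-cartesianProductWith⁺)
open import Data.List.Relation.Unary.Any using (here; there)
open import Data.Nat.Base
  using (ℕ; zero; suc; pred; _+_; _∸_; _≤_; _<_; z≤n; s≤s; s≤s⁻¹; ∣_-_∣)
open import Data.Nat.GeneralisedArithmetic using (fold; fold-+)
open import Data.Nat.Properties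
open import Data.Product.Base using (∃; ∃₂; _×_; _,_; proj₁; proj₂)
open import Data.Sum.Base using (_⊎_; inj₁; inj₂)
open import Data.Vec.Base using (Vec; []; _∷_; lookup; map)
open import Data.Vec.Relation.Binary.Pointwise.Inductive using (Pointwise; []; _∷_)
import Function.Bundles as Bundles
open import Function.Base using (_∘_; _on_)
open import Level using (0ℓ)
open import Relation.Binary.Construct.Closure.ReflexiveTransitive
  using (Star; ε; _◅_; _◅◅_)
open import Relation.Binary.Construct.Closure.Transitive
  using ([_]; _∷_; symmetric; transitive)
import Relation.Binary.Construct.On as On
open import Relation.Binary.Core using (Rel; _⇔_; _⇒_)
open import Relation.Binary.Definitions using (tri<; tri≈; tri>)
open import Relation.Binary.PropositionalEquality
  using (_≡_; _≢_; refl; sym; trans; cong; cong₂; subst; isEquivalence)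
open import Relation.Binary.Structures using (IsEquivalence)
open import Relation.Nullary.Decidable.Core using (yes; no; ¬¬-excluded-middle)
open import Relation.Nullary.Negation.Core using (¬_; contradiction)
open import Relation.Unary using (Pred)

-- Combinators for total recursive functions

↓-respects-≡ : ∀ {n} {f : PartialRec n} {xs y z} → y ≡ z → f [ xs ]↓ y → f [ xs ]↓ z
↓-respects-≡ refl d = d

record TotalRec (n : ℕ) : Set where
  field
    prog  : PartialRec n
    fun   : Vec ℕ n → ℕ
    total : ∀ xs → prog [ xs ]↓ fun xs
open TotalRec

var : ∀ {n} → Fin n → TotalRec n
var i .prog     = proj i
var i .fun xs   = lookup xs i
var i .total xs = ↓proj

lit : ∀ {n} → ℕ → TotalRec n
lit zero    .prog     = comp zeroᶠ []
lit zero    .fun xs   = 0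
lit zero    .total xs = ↓comp [] ↓zero
lit (suc k) .prog     = comp sucᶠ (lit k .prog ∷ [])
lit (suc k) .fun xs   = suc (lit k .fun xs)
lit (suc k) .total xs = ↓comp (lit k .total xs ∷ []) ↓suc

infixl 8 _⟨$⟩_

_⟨$⟩_ : ∀ {m n} → TotalRec m → Vec (TotalRec n) m → TotalRec n
(f ⟨$⟩ gs) .prog     = comp (f .prog) (map prog gs)
(f ⟨$⟩ gs) .fun xs   = f .fun (map (λ g → g .fun xs) gs)
(f ⟨$⟩ gs) .total xs = ↓comp (totals gs) (f .total _)
  where
  totals : ∀ {m} (gs : Vec _ m) →
           Pointwise (λ g y → g [ xs ]↓ y) (map prog gs) (map (λ g → g .fun xs) gs)
  totals []       = []
  totals (g ∷ gs) = g .total xs ∷ totals gs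

sucᵣ : ∀ {n} → TotalRec n → TotalRec n
sucᵣ a .prog     = comp sucᶠ (a .prog ∷ [])
sucᵣ a .fun xs   = suc (a .fun xs)
sucᵣ a .total xs = ↓comp (a .total xs ∷ []) ↓suc

primRec : ∀ {n} → TotalRec n → TotalRec (suc (suc n)) → TotalRec (suc n)
primRec f g .prog                 = prec (f .prog) (g .prog)
primRec f g .fun (zero ∷ xs)      = f .fun xs
primRec f g .fun (suc k ∷ xs)     = g .fun (k ∷ primRec f g .fun (k ∷ xs) ∷ xs)
primRec f g .total (zero ∷ xs)    = ↓prec-zero (f .total xs)
primRec f g .total (suc k ∷ xs)   = ↓prec-suc (primRec f g .total (k ∷ xs)) (g .total _)

-- `fun` becomes the given `f` instead of the recursion inside `R`. Composites then compute to
-- ordinary arithmetic, and `kernel labelFᵣ` agrees with `F` definitionally.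
lift₁ : (R : TotalRec 1) (f : ℕ → ℕ) → (∀ x → R .fun (x ∷ []) ≡ f x) →
        ∀ {n} → TotalRec n → TotalRec n
lift₁ R f eq a .prog     = (R ⟨$⟩ (a ∷ [])) .prog
lift₁ R f eq a .fun xs   = f (a .fun xs)
lift₁ R f eq a .total xs = ↓-respects-≡ (eq _) ((R ⟨$⟩ (a ∷ [])) .total xs)

lift₂ : (R : TotalRec 2) (f : ℕ → ℕ → ℕ) → (∀ x y → R .fun (x ∷ y ∷ []) ≡ f x y) →
        ∀ {n} → TotalRec n → TotalRec n → TotalRec n
lift₂ R f eq a b .prog     = (R ⟨$⟩ (a ∷ b ∷ [])) .prog
lift₂ R f eq a b .fun xs   = f (a .fun xs) (b .fun xs)
lift₂ R f eq a b .total xs = ↓-respects-≡ (eq _ _) ((R ⟨$⟩ (a ∷ b ∷ [])) .total xs)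

infixl 6 _+ᵣ_ _∸ᵣ_

_+ᵣ_ : ∀ {n} → TotalRec n → TotalRec n → TotalRec n
_+ᵣ_ = lift₂ plus _+_ plus-+
  where
  plus : TotalRec 2
  plus = primRec (var 0F) (sucᵣ (var 1F))
  plus-+ : ∀ x y → plus .fun (x ∷ y ∷ []) ≡ x + y
  plus-+ zero    y = refl
  plus-+ (suc x) y = cong suc (plus-+ x y)

predᵣ : ∀ {n} → TotalRec n → TotalRec n
predᵣ = lift₁ (primRec (lit 0) (var 0F)) pred λ { zero → refl ; (suc _) → refl }

_∸ᵣ_ : ∀ {n} → TotalRec n → TotalRec n → TotalRec n
-- Primitive recursion runs on the first argument, so `monus` takes the subtrahend first.
a ∸ᵣ b = lift₂ monus (λ x y → y ∸ x) monus-∸ b a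
  where
  monus : TotalRec 2
  monus = primRec (var 0F) (predᵣ (var 1F))
  monus-∸ : ∀ x y → monus .fun (x ∷ y ∷ []) ≡ y ∸ x
  monus-∸ zero    y = refl
  monus-∸ (suc x) y = trans (cong pred (monus-∸ x y)) (pred[m∸n]≡m∸[1+n] y x)

∣_-ᵣ_∣ : ∀ {n} → TotalRec n → TotalRec n → TotalRec n
∣_-ᵣ_∣ = lift₂ ((var 0F ∸ᵣ var 1F) +ᵣ (var 1F ∸ᵣ var 0F)) ∣_-_∣ distance
  where
  distance : ∀ x y → (x ∸ y) + (y ∸ x) ≡ ∣ x - y ∣
  distance zero    zero    = refl
  distance zero    (suc y) = refl
  distance (suc x) zero    = +-identityʳ (suc x)
  distance (suc x) (suc y) = distance x y

ifZero : ℕ → ℕ → ℕ → ℕ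
ifZero zero    a b = a
ifZero (suc _) a b = b

infix 5 ifZeroᵣ_then_else_

ifZeroᵣ_then_else_ : ∀ {n} → TotalRec n → TotalRec n → TotalRec n → TotalRec n
(ifZeroᵣ c then a else b) .prog =
  -- Recursion on the condition serves as a case split: the step function sees predecessor, previous
  -- value, `a`, `b`, and `proj 3F` picks `b`.
  comp (prec (proj 0F) (proj 3F)) (c .prog ∷ a .prog ∷ b .prog ∷ [])
(ifZeroᵣ c then a else b) .fun xs = ifZero (c .fun xs) (a .fun xs) (b .fun xs)
(ifZeroᵣ c then a else b) .total xs =
  ↓comp (c .total xs ∷ a .total xs ∷ b .total xs ∷ []) (branch (c .fun xs) _ _)
  where
  branch : ∀ c a b → prec (proj 0F) (proj 3F) [ c ∷ a ∷ b ∷ [] ]↓ ifZero c a b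
  branch zero    a b = ↓prec-zero ↓proj
  branch (suc c) a b = ↓prec-suc (branch c a b) ↓proj

-- The Cantor pairing function

tri : ℕ → ℕ
tri zero    = 0
tri (suc k) = suc k + tri k

-- The largest r with tri r ≤ n.
triRoot : ℕ → ℕ
triRoot zero    = 0
triRoot (suc n) =
  ifZero (tri (suc (triRoot n)) ∸ suc n) (suc (triRoot n)) (triRoot n)

tri-mono-≤ : ∀ {m n} → m ≤ n → tri m ≤ tri n
tri-mono-≤ z≤n         = z≤n
tri-mono-≤ (s≤s m≤n) = +-mono-≤ (s≤s m≤n) (tri-mono-≤ m≤n)

triRoot-bounds : ∀ n → tri (triRoot n) ≤ n × n < tri (suc (triRoot n))
triRoot-bounds zero = z≤n , s≤s z≤n
triRoot-bounds (suc n)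
  with lower , upper ← triRoot-bounds n
  with tri (suc (triRoot n)) ∸ suc n in eq
... | zero  = m∸n≡0⇒m≤n eq , ≤-<-trans upper (s≤s (m≤n+m _ (suc (triRoot n))))
... | suc _ = m≤n⇒m≤1+n lower , ≰⇒> λ le → 1+n≢0 (trans (sym eq) (m≤n⇒m∸n≡0 le))

-- As `tri` is monotone, the half-open intervals from `tri r` to `tri (suc r)` are disjoint.
triRoot-unique : ∀ {n r} → tri r ≤ n → n < tri (suc r) → triRoot n ≡ r
triRoot-unique {n} {r} lower upper with <-cmp (triRoot n) r
... | tri< lt _ _ = contradiction
        (≤-trans (proj₂ (triRoot-bounds n)) (≤-trans (tri-mono-≤ lt) lower)) (n≮n _)
... | tri≈ _ eq _ = eq
... | tri> _ _ gt = contradiction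
        (≤-trans upper (≤-trans (tri-mono-≤ gt) (proj₁ (triRoot-bounds n)))) (n≮n _)

triᵣ : ∀ {n} → TotalRec n → TotalRec n
triᵣ = lift₁ R tri eq
  where
  R : TotalRec 1
  R = primRec (lit 0) (sucᵣ (var 0F) +ᵣ var 1F)
  eq : ∀ x → R .fun (x ∷ []) ≡ tri x
  eq zero    = refl
  eq (suc x) = cong (suc x +_) (eq x)

triRootᵣ : ∀ {n} → TotalRec n → TotalRec n
triRootᵣ = lift₁ R triRoot eq
  where
  R : TotalRec 1
  R = primRec (lit 0)
        (ifZeroᵣ triᵣ (sucᵣ (var 1F)) ∸ᵣ sucᵣ (var 0F) then sucᵣ (var 1F) else var 1F)
  eq : ∀ x → R .fun (x ∷ []) ≡ triRoot x
  eq zero    = refl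
  eq (suc x) = cong (λ r → ifZero (tri (suc r) ∸ suc x) (suc r) r) (eq x)

-- Sealed so that codes keep the form `⟨ x , y ⟩`, on which `rewrite` with the projection laws can
-- act. The equations proved in this block are the interface.
opaque
  ⟨_,_⟩ : ℕ → ℕ → ℕ
  ⟨ x , y ⟩ = tri (x + y) + y

  π₂ : ℕ → ℕ
  π₂ n = n ∸ tri (triRoot n)

  π₁ : ℕ → ℕ
  π₁ n = triRoot n ∸ π₂ n

  triRoot-⟨,⟩ : ∀ x y → triRoot ⟨ x , y ⟩ ≡ x + y
  triRoot-⟨,⟩ x y = triRoot-unique (m≤m+n _ y)
    (s≤s (≤-trans (+-monoʳ-≤ (tri (x + y)) (m≤n+m y x)) (≤-reflexive (+-comm _ (x + y)))))

  π₂-⟨,⟩ : ∀ x y → π₂ ⟨ x , y ⟩ ≡ y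
  π₂-⟨,⟩ x y rewrite triRoot-⟨,⟩ x y = m+n∸m≡n (tri (x + y)) y

  π₁-⟨,⟩ : ∀ x y → π₁ ⟨ x , y ⟩ ≡ x
  π₁-⟨,⟩ x y rewrite π₂-⟨,⟩ x y | triRoot-⟨,⟩ x y = m+n∸n≡m x y

  ⟨π₁,π₂⟩ : ∀ n → ⟨ π₁ n , π₂ n ⟩ ≡ n
  ⟨π₁,π₂⟩ n
    with lower , upper ← triRoot-bounds n
    -- The upper bound gives `π₂ n ≤ triRoot n`, so the truncated subtraction in `π₁` is exact.
    rewrite m∸n+n≡m {triRoot n} {π₂ n}
              (m≤n+o⇒m∸n≤o n (tri (triRoot n))
                (≤-trans (s≤s⁻¹ upper) (≤-reflexive (+-comm (triRoot n) _))))
    = m+[n∸m]≡n lower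

  pairᵣ : TotalRec 2
  pairᵣ = triᵣ (var 0F +ᵣ var 1F) +ᵣ var 1F

  pairᵣ-⟨,⟩ : ∀ x y → pairᵣ .fun (x ∷ y ∷ []) ≡ ⟨ x , y ⟩
  pairᵣ-⟨,⟩ x y = refl

  sndᵣ : TotalRec 1
  sndᵣ = var 0F ∸ᵣ triᵣ (triRootᵣ (var 0F))

  sndᵣ-π₂ : ∀ x → sndᵣ .fun (x ∷ []) ≡ π₂ x
  sndᵣ-π₂ x = refl

  fstᵣ : TotalRec 1
  fstᵣ = triRootᵣ (var 0F) ∸ᵣ sndᵣ

  fstᵣ-π₁ : ∀ x → fstᵣ .fun (x ∷ []) ≡ π₁ x
  fstᵣ-π₁ x = refl

⟨_,_⟩ᵣ : ∀ {n} → TotalRec n → TotalRec n → TotalRec n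
⟨_,_⟩ᵣ = lift₂ pairᵣ ⟨_,_⟩ pairᵣ-⟨,⟩

π₁ᵣ π₂ᵣ : ∀ {n} → TotalRec n → TotalRec n
π₁ᵣ = lift₁ fstᵣ π₁ fstᵣ-π₁
π₂ᵣ = lift₁ sndᵣ π₂ sndᵣ-π₂

-- An abstract machine for partial recursive functions

-- A state is ⟨ K , v ⟩, with v the current value and K a stack of instructions
-- ⟨ tag , argument ⟩.  FORK′, PREC′ and TEST are closures created at run time,
-- holding a saved value; so is CONS, except for its use in ⌜ μ f ⌝.

infixr 5 _▷_
_▷_ : ℕ → ℕ → ℕ
i ▷ K = ⟨ i , K ⟩

HALT ZERO SUC HEAD TAIL : ℕ
HALT = ⟨ 0 , 0 ⟩
ZERO = ⟨ 1 , 0 ⟩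
SUC  = ⟨ 2 , 0 ⟩
HEAD = ⟨ 3 , 0 ⟩
TAIL = ⟨ 4 , 0 ⟩

SEQ FORK FORK′ PREC PREC′ TEST : ℕ → ℕ → ℕ
CONS MU : ℕ → ℕ
SEQ   a b = ⟨ 5  , ⟨ a , b ⟩ ⟩
FORK  a b = ⟨ 6  , ⟨ a , b ⟩ ⟩
FORK′ b v = ⟨ 7  , ⟨ b , v ⟩ ⟩
CONS  y   = ⟨ 8  , y ⟩
PREC  f g = ⟨ 9  , ⟨ f , g ⟩ ⟩
PREC′ g v = ⟨ 10 , ⟨ g , v ⟩ ⟩
MU    f   = ⟨ 11 , f ⟩
TEST  f v = ⟨ 12 , ⟨ f , v ⟩ ⟩

output : ℕ → ℕ
output z = ⟨ HALT ▷ 0 , z ⟩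

-- Halting leads to the fixed point dead, so that a run passes through at most
-- one of the states output 0 and output 1, and only once.
dead : ℕ
dead = output 2

-- By truncated subtraction tag -1- k vanishes iff tag ≤ suc k; the branches
-- above have already dealt with the smaller tags.
dispatchᵣ : TotalRec 4
dispatchᵣ =
  ifZeroᵣ tag       then ⟨ ⟨ ⟨ lit 0 , lit 0 ⟩ᵣ , lit 0 ⟩ᵣ , lit 2 ⟩ᵣ else
  ifZeroᵣ tag -1- 0 then ⟨ K , lit 0 ⟩ᵣ else
  ifZeroᵣ tag -1- 1 then ⟨ K , sucᵣ (π₁ᵣ v) ⟩ᵣ else
  ifZeroᵣ tag -1- 2 then ⟨ K , π₁ᵣ v ⟩ᵣ else
  ifZeroᵣ tag -1- 3 then ⟨ K , π₂ᵣ v ⟩ᵣ else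
  ifZeroᵣ tag -1- 4 then ⟨ ⟨ p₁ , ⟨ p₂ , K ⟩ᵣ ⟩ᵣ , v ⟩ᵣ else
  ifZeroᵣ tag -1- 5 then ⟨ ⟨ p₁ , ⟨ ⟨ lit 7 , ⟨ p₂ , v ⟩ᵣ ⟩ᵣ , K ⟩ᵣ ⟩ᵣ , v ⟩ᵣ else
  ifZeroᵣ tag -1- 6 then ⟨ ⟨ p₁ , ⟨ ⟨ lit 8 , v ⟩ᵣ , K ⟩ᵣ ⟩ᵣ , p₂ ⟩ᵣ else
  ifZeroᵣ tag -1- 7 then ⟨ K , ⟨ p , v ⟩ᵣ ⟩ᵣ else
  ifZeroᵣ tag -1- 8 then
    (ifZeroᵣ π₁ᵣ v then ⟨ ⟨ p₁ , K ⟩ᵣ , π₂ᵣ v ⟩ᵣ else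
     ⟨ ⟨ ⟨ lit 9 , p ⟩ᵣ , ⟨ ⟨ lit 10 , ⟨ p₂ , v⁻ ⟩ᵣ ⟩ᵣ , K ⟩ᵣ ⟩ᵣ , v⁻ ⟩ᵣ) else
  ifZeroᵣ tag -1- 9 then ⟨ ⟨ p₁ , K ⟩ᵣ , ⟨ π₁ᵣ p₂ , ⟨ v , π₂ᵣ p₂ ⟩ᵣ ⟩ᵣ ⟩ᵣ else
  ifZeroᵣ tag -1- 10 then ⟨ ⟨ p , ⟨ ⟨ lit 12 , ⟨ p , v ⟩ᵣ ⟩ᵣ , K ⟩ᵣ ⟩ᵣ , v ⟩ᵣ else
  -- Tags above 12 also land here and act as `TEST`, so `step` is total on all numbers, including
  -- those that code no program.
  (ifZeroᵣ v then ⟨ K , π₁ᵣ p₂ ⟩ᵣ else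
   ⟨ ⟨ ⟨ lit 11 , p₁ ⟩ᵣ , K ⟩ᵣ , ⟨ sucᵣ (π₁ᵣ p₂) , π₂ᵣ p₂ ⟩ᵣ ⟩ᵣ)
  where
  tag p p₁ p₂ K v v⁻ : TotalRec 4
  tag = var 0F
  p   = var 1F
  p₁  = π₁ᵣ p
  p₂  = π₂ᵣ p
  K   = var 2F
  v   = var 3F
  v⁻  = ⟨ predᵣ (π₁ᵣ v) , π₂ᵣ v ⟩ᵣ

  infix 6 _-1-_
  _-1-_ : TotalRec 4 → ℕ → TotalRec 4
  t -1- k = t ∸ᵣ lit (suc k)

stepRec : TotalRec 1
stepRec = dispatchᵣ ⟨$⟩ (π₁ᵣ i ∷ π₂ᵣ i ∷ π₂ᵣ (π₁ᵣ s) ∷ π₂ᵣ s ∷ [])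
  where
  s i : TotalRec 1
  s = var 0F
  i = π₁ᵣ (π₁ᵣ s)

opaque
  step : ℕ → ℕ
  step s = stepRec .fun (s ∷ [])

  stepRec-step : ∀ s → stepRec .fun (s ∷ []) ≡ step s
  stepRec-step s = refl

  step-▷ : ∀ t p K v →
           step ⟨ ⟨ t , p ⟩ ▷ K , v ⟩ ≡ dispatchᵣ .fun (t ∷ p ∷ K ∷ v ∷ [])
  step-▷ t p K v
    rewrite π₁-⟨,⟩ (⟨ t , p ⟩ ▷ K) v | π₂-⟨,⟩ (⟨ t , p ⟩ ▷ K) v
          | π₁-⟨,⟩ ⟨ t , p ⟩ K | π₂-⟨,⟩ ⟨ t , p ⟩ K | π₁-⟨,⟩ t p | π₂-⟨,⟩ t p = refl

stepᵣ : ∀ {n} → TotalRec n → TotalRec n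
stepᵣ = lift₁ stepRec step stepRec-step

step-HALT : ∀ K v → step ⟨ HALT ▷ K , v ⟩ ≡ dead
step-HALT = step-▷ 0 0

infix 4 _⟶_ _⇝_

_⟶_ _⇝_ : Rel ℕ 0ℓ
s ⟶ t = step s ≡ t
_⇝_   = Star _⟶_

module _ {K : ℕ} where

  ZERO-⟶ : ∀ {v} → ⟨ ZERO ▷ K , v ⟩ ⟶ ⟨ K , 0 ⟩
  ZERO-⟶ = step-▷ 1 _ _ _

  SUC-⟶ : ∀ {x v} → ⟨ SUC ▷ K , ⟨ x , v ⟩ ⟩ ⟶ ⟨ K , suc x ⟩
  SUC-⟶ {x} {v} rewrite step-▷ 2 0 K ⟨ x , v ⟩ | π₁-⟨,⟩ x v = refl

  HEAD-⟶ : ∀ {x v} → ⟨ HEAD ▷ K , ⟨ x , v ⟩ ⟩ ⟶ ⟨ K , x ⟩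
  HEAD-⟶ {x} {v} rewrite step-▷ 3 0 K ⟨ x , v ⟩ | π₁-⟨,⟩ x v = refl

  TAIL-⟶ : ∀ {x v} → ⟨ TAIL ▷ K , ⟨ x , v ⟩ ⟩ ⟶ ⟨ K , v ⟩
  TAIL-⟶ {x} {v} rewrite step-▷ 4 0 K ⟨ x , v ⟩ | π₂-⟨,⟩ x v = refl

  SEQ-⟶ : ∀ {a b v} → ⟨ SEQ a b ▷ K , v ⟩ ⟶ ⟨ a ▷ b ▷ K , v ⟩
  SEQ-⟶ {a} {b} {v}
    rewrite step-▷ 5 ⟨ a , b ⟩ K v | π₁-⟨,⟩ a b | π₂-⟨,⟩ a b = refl

  FORK-⟶ : ∀ {a b v} → ⟨ FORK a b ▷ K , v ⟩ ⟶ ⟨ a ▷ FORK′ b v ▷ K , v ⟩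
  FORK-⟶ {a} {b} {v}
    rewrite step-▷ 6 ⟨ a , b ⟩ K v | π₁-⟨,⟩ a b | π₂-⟨,⟩ a b = refl

  FORK′-⟶ : ∀ {b v y} → ⟨ FORK′ b v ▷ K , y ⟩ ⟶ ⟨ b ▷ CONS y ▷ K , v ⟩
  FORK′-⟶ {b} {v} {y}
    rewrite step-▷ 7 ⟨ b , v ⟩ K y | π₁-⟨,⟩ b v | π₂-⟨,⟩ b v = refl

  CONS-⟶ : ∀ {y v} → ⟨ CONS y ▷ K , v ⟩ ⟶ ⟨ K , ⟨ y , v ⟩ ⟩
  CONS-⟶ = step-▷ 8 _ _ _

  PREC-zero-⟶ : ∀ {f g v} → ⟨ PREC f g ▷ K , ⟨ 0 , v ⟩ ⟩ ⟶ ⟨ f ▷ K , v ⟩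
  PREC-zero-⟶ {f} {g} {v}
    rewrite step-▷ 9 ⟨ f , g ⟩ K ⟨ 0 , v ⟩
          | π₁-⟨,⟩ f g | π₁-⟨,⟩ 0 v | π₂-⟨,⟩ 0 v = refl

  PREC-suc-⟶ : ∀ {f g k v} → ⟨ PREC f g ▷ K , ⟨ suc k , v ⟩ ⟩ ⟶
               ⟨ PREC f g ▷ PREC′ g ⟨ k , v ⟩ ▷ K , ⟨ k , v ⟩ ⟩
  PREC-suc-⟶ {f} {g} {k} {v}
    rewrite step-▷ 9 ⟨ f , g ⟩ K ⟨ suc k , v ⟩
          | π₂-⟨,⟩ f g | π₁-⟨,⟩ (suc k) v | π₂-⟨,⟩ (suc k) v = refl

  PREC′-⟶ : ∀ {g k v r} →
            ⟨ PREC′ g ⟨ k , v ⟩ ▷ K , r ⟩ ⟶ ⟨ g ▷ K , ⟨ k , ⟨ r , v ⟩ ⟩ ⟩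
  PREC′-⟶ {g} {k} {v} {r}
    rewrite step-▷ 10 ⟨ g , ⟨ k , v ⟩ ⟩ K r
          | π₁-⟨,⟩ g ⟨ k , v ⟩ | π₂-⟨,⟩ g ⟨ k , v ⟩ | π₁-⟨,⟩ k v | π₂-⟨,⟩ k v = refl

  MU-⟶ : ∀ {f v} → ⟨ MU f ▷ K , v ⟩ ⟶ ⟨ f ▷ TEST f v ▷ K , v ⟩
  MU-⟶ = step-▷ 11 _ _ _

  TEST-zero-⟶ : ∀ {f i v} → ⟨ TEST f ⟨ i , v ⟩ ▷ K , 0 ⟩ ⟶ ⟨ K , i ⟩
  TEST-zero-⟶ {f} {i} {v}
    rewrite step-▷ 12 ⟨ f , ⟨ i , v ⟩ ⟩ K 0
          | π₂-⟨,⟩ f ⟨ i , v ⟩ | π₁-⟨,⟩ i v = refl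

  TEST-suc-⟶ : ∀ {f i v k} →
               ⟨ TEST f ⟨ i , v ⟩ ▷ K , suc k ⟩ ⟶ ⟨ MU f ▷ K , ⟨ suc i , v ⟩ ⟩
  TEST-suc-⟶ {f} {i} {v} {k}
    rewrite step-▷ 12 ⟨ f , ⟨ i , v ⟩ ⟩ K (suc k)
          | π₁-⟨,⟩ f ⟨ i , v ⟩ | π₂-⟨,⟩ f ⟨ i , v ⟩ | π₁-⟨,⟩ i v | π₂-⟨,⟩ i v = refl

-- Compilation of programs and its correctness

env : ∀ {n} → Vec ℕ n → ℕ
env []       = 0
env (x ∷ xs) = ⟨ x , env xs ⟩

⌜_⌝ᵖ : ∀ {n} → Fin n → ℕ
⌜ zero ⌝ᵖ  = HEAD
⌜ suc i ⌝ᵖ = SEQ TAIL ⌜ i ⌝ᵖ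

-- Invariant of the compilation: the instruction `⌜ f ⌝` replaces the value `env xs` by the result
-- of `f` on `xs` and leaves the stack below it unchanged.
⌜_⌝  : ∀ {n} → PartialRec n → ℕ
⌜_⌝* : ∀ {m n} → Vec (PartialRec n) m → ℕ

⌜ zeroᶠ ⌝     = ZERO
⌜ sucᶠ ⌝      = SUC
⌜ proj i ⌝    = ⌜ i ⌝ᵖ
⌜ comp f gs ⌝ = SEQ ⌜ gs ⌝* ⌜ f ⌝
⌜ prec f g ⌝  = PREC ⌜ f ⌝ ⌜ g ⌝
-- `CONS 0` puts the first candidate in front of the arguments.
⌜ μ f ⌝       = SEQ (CONS 0) (MU ⌜ f ⌝)

⌜ [] ⌝*     = ZERO
⌜ g ∷ gs ⌝* = FORK ⌜ g ⌝ ⌜ gs ⌝*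

lookup-⇝ : ∀ {n} (i : Fin n) xs {K} → ⟨ ⌜ i ⌝ᵖ ▷ K , env xs ⟩ ⇝ ⟨ K , lookup xs i ⟩
lookup-⇝ zero    (x ∷ xs) = HEAD-⟶ ◅ ε
lookup-⇝ (suc i) (x ∷ xs) = SEQ-⟶ ◅ TAIL-⟶ ◅ lookup-⇝ i xs

-- Induction on the distance `d` from the current candidate `i` to the root `y`. The hypotheses hold
-- for every stack because `f` runs with a `TEST` pushed below it.
MU-⇝ : ∀ {f v y} →
       (∀ {K} → ⟨ f ▷ K , ⟨ y , v ⟩ ⟩ ⇝ ⟨ K , 0 ⟩) →
       (∀ {i} → i < y → ∃ λ k → ∀ {K} → ⟨ f ▷ K , ⟨ i , v ⟩ ⟩ ⇝ ⟨ K , suc k ⟩) →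
       ∀ {K} d {i} → d + i ≡ y → ⟨ MU f ▷ K , ⟨ i , v ⟩ ⟩ ⇝ ⟨ K , y ⟩
MU-⇝ root below zero    refl = MU-⟶ ◅ root ◅◅ TEST-zero-⟶ ◅ ε
MU-⇝ root below (suc d) {i} refl =
  MU-⟶ ◅ proj₂ (below (s≤s (m≤n+m i d))) ◅◅ TEST-suc-⟶ ◅
  MU-⇝ root below d (+-suc d i)

-- Induction on the derivation; quantifying over `K` lets the induction hypotheses apply below the
-- closures pushed on the way. `eval-suc-⇝` unpacks the existential in `↓μ` by matching, which keeps
-- the recursion structural.
eval-⇝ : ∀ {n} {f : PartialRec n} {xs z} → f [ xs ]↓ z →
         ∀ {K} → ⟨ ⌜ f ⌝ ▷ K , env xs ⟩ ⇝ ⟨ K , z ⟩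
evals-⇝ : ∀ {m n} {gs : Vec (PartialRec n) m} {xs ys} →
          Pointwise (λ g y → g [ xs ]↓ y) gs ys →
          ∀ {K} → ⟨ ⌜ gs ⌝* ▷ K , env xs ⟩ ⇝ ⟨ K , env ys ⟩
eval-suc-⇝ : ∀ {n} {f : PartialRec n} {xs} → (∃ λ k → f [ xs ]↓ suc k) →
             ∃ λ k → ∀ {K} → ⟨ ⌜ f ⌝ ▷ K , env xs ⟩ ⇝ ⟨ K , suc k ⟩

eval-⇝ ↓zero              = ZERO-⟶ ◅ ε
eval-⇝ ↓suc               = SUC-⟶ ◅ ε
eval-⇝ (↓proj {i = i} {xs}) = lookup-⇝ i xs
eval-⇝ (↓comp ds d)       = SEQ-⟶ ◅ evals-⇝ ds ◅◅ eval-⇝ d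
eval-⇝ (↓prec-zero d)     = PREC-zero-⟶ ◅ eval-⇝ d
eval-⇝ (↓prec-suc d e)    = PREC-suc-⟶ ◅ eval-⇝ d ◅◅ PREC′-⟶ ◅ eval-⇝ e
eval-⇝ (↓μ {y = y} d below) =
  SEQ-⟶ ◅ CONS-⟶ ◅
  MU-⇝ (eval-⇝ d) (λ i<y → eval-suc-⇝ (below i<y)) y (+-identityʳ y)

evals-⇝ []       = ZERO-⟶ ◅ ε
evals-⇝ (d ∷ ds) = FORK-⟶ ◅ eval-⇝ d ◅◅ FORK′-⟶ ◅ evals-⇝ ds ◅◅ CONS-⟶ ◅ ε

eval-suc-⇝ (k , d) = k , eval-⇝ d

-- Runs of a program on its own code

⇝⇒fold : ∀ {s t} → s ⇝ t → ∃ λ n → fold s step n ≡ t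
⇝⇒fold ε = 0 , refl
⇝⇒fold {s} (refl ◅ r) with n , refl ← ⇝⇒fold r =
  -- `fold` has the last step outermost, a path its first step in front; reading `suc n` as `n + 1`
  -- lets `fold-+` split off the first step.
  suc n , trans (cong (fold s step) (+-comm 1 n)) (fold-+ s step n)

-- The diagonal is built in: the program `e` starts on the one-element environment holding `e`.
init : ℕ → ℕ
init e = ⟨ e ▷ HALT ▷ 0 , ⟨ e , 0 ⟩ ⟩

run : ℕ → ℕ → ℕ
run t e = fold (init e) step t

runᵣ : ∀ {n} → TotalRec n → TotalRec n → TotalRec n
runᵣ = lift₂ R run R-run
  where
  R : TotalRec 2
  R = primRec
        ⟨ ⟨ var 0F , ⟨ ⟨ lit 0 , lit 0 ⟩ᵣ , lit 0 ⟩ᵣ ⟩ᵣ , ⟨ var 0F , lit 0 ⟩ᵣ ⟩ᵣ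
        (stepᵣ (var 1F))
  R-run : ∀ t e → R .fun (t ∷ e ∷ []) ≡ run t e
  R-run zero    e = refl
  R-run (suc t) e = cong step (R-run t e)

run-output : ∀ {d : PartialRec 1} {z} → d [ ⌜ d ⌝ ∷ [] ]↓ z →
             ∃ λ t → run t ⌜ d ⌝ ≡ output z
run-output d↓z = ⇝⇒fold (eval-⇝ d↓z)

output-injective : ∀ {x y} → output x ≡ output y → x ≡ y
output-injective {x} {y} eq =
  trans (sym (π₂-⟨,⟩ _ x)) (trans (cong π₂ eq) (π₂-⟨,⟩ _ y))

fold-dead : ∀ n → fold dead step n ≡ dead
fold-dead zero    = refl
fold-dead (suc n) = trans (cong step (fold-dead n)) (step-HALT 0 2)

dead-after-output : ∀ {e z m n} → run m e ≡ output z → m < n → run n e ≡ dead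
dead-after-output {e} {z} {m} eq m<n with o , refl ← m≤n⇒∃[o]m+o≡n m<n =
  trans (cong (fold (init e) step) (+-comm (suc m) o))
    (trans (fold-+ (init e) step o)
      (trans (cong (λ s → fold s step o) (trans (cong step eq) (step-HALT 0 z)))
        (fold-dead o)))

-- After an output the state is `dead`, that is `output 2`, so any other value shows at one time
-- only. With equal values this bounds the classes; with the values 0 and 1 it closes the diagonal
-- argument.
output-once : ∀ {e x y m n} → x ≢ 2 → y ≢ 2 →
              run m e ≡ output x → run n e ≡ output y → m ≡ n
output-once {e} {m = m} {n} x≢2 y≢2 eqˣ eqʸ with <-cmp m n
... | tri< m<n _ _ = contradiction
        (output-injective (trans (sym eqʸ) (dead-after-output {e} eqˣ m<n))) y≢2
... | tri≈ _ m≡n _ = m≡n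
... | tri> _ _ n<m = contradiction
        (output-injective (trans (sym eqˣ) (dead-after-output {e} eqʸ n<m))) x≢2

-- The relations `F` and `G`

-- The value 0 means that the program π₁ u, run on its own code, outputs 0 at
-- time π₂ u exactly.
pending : ℕ → ℕ
pending u = ∣ run (π₂ u) (π₁ u) - output 0 ∣

pendingᵣ : ∀ {n} → TotalRec n → TotalRec n
pendingᵣ u =
  ∣ runᵣ (π₂ᵣ u) (π₁ᵣ u) -ᵣ ⟨ ⟨ ⟨ lit 0 , lit 0 ⟩ᵣ , lit 0 ⟩ᵣ , lit 0 ⟩ᵣ ∣

pending-unique : ∀ {u w} → pending u ≡ 0 → pending w ≡ 0 → π₁ u ≡ π₁ w → u ≡ w
pending-unique {u} {w} pu pw eq =
  trans (sym (⟨π₁,π₂⟩ u)) (trans (cong₂ ⟨_,_⟩ eq times) (⟨π₁,π₂⟩ w))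
  where
  times : π₂ u ≡ π₂ w
  times = output-once {π₁ w} (λ ()) (λ ())
    (trans (cong (run (π₂ u)) (sym eq)) (∣m-n∣≡0⇒m≡n pu)) (∣m-n∣≡0⇒m≡n pw)

collapse : ℕ → ℕ
collapse u = ifZero (pending u) ⟨ π₁ u , 0 ⟩ u

-- In labelG, pred identifies 0 with 1 and nothing else.
labelF labelG : ℕ → ℕ
labelF x = ⟨ collapse (π₁ x) , π₂ x ⟩
labelG x = ⟨ π₁ x , ifZero (pending (π₁ x)) (pred (π₂ x)) (π₂ x) ⟩

labelFᵣ labelGᵣ : TotalRec 1
labelFᵣ = ⟨ (ifZeroᵣ pendingᵣ u then ⟨ π₁ᵣ u , lit 0 ⟩ᵣ else u) , π₂ᵣ (var 0F) ⟩ᵣ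
  where u = π₁ᵣ (var 0F)
labelGᵣ = ⟨ u , (ifZeroᵣ pendingᵣ u then predᵣ ε′ else ε′) ⟩ᵣ
  where
  u  = π₁ᵣ (var 0F)
  ε′ = π₂ᵣ (var 0F)

-- Being kernels of recursive labellings makes both relations equivalences, decided by comparing
-- labels.
F G : Rel ℕ 0ℓ
F = _≡_ on labelF
G = _≡_ on labelG

-- Determinism of evaluation

deterministic : ∀ {n} {f : PartialRec n} {xs y z} →
                f [ xs ]↓ y → f [ xs ]↓ z → y ≡ z
deterministic* : ∀ {m n} {gs : Vec (PartialRec n) m} {xs ys zs} →
                 Pointwise (λ g y → g [ xs ]↓ y) gs ys →
                 Pointwise (λ g y → g [ xs ]↓ y) gs zs → ys ≡ zs
suc-not-zero : ∀ {n} {f : PartialRec n} {xs} →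
               (∃ λ k → f [ xs ]↓ suc k) → ¬ f [ xs ]↓ 0

deterministic ↓zero ↓zero = refl
deterministic ↓suc ↓suc = refl
deterministic ↓proj ↓proj = refl
deterministic (↓comp ds d) (↓comp ds′ d′)
  with refl ← deterministic* ds ds′ = deterministic d d′
deterministic (↓prec-zero d) (↓prec-zero d′) = deterministic d d′
deterministic (↓prec-suc d e) (↓prec-suc d′ e′)
  with refl ← deterministic d d′ = deterministic e e′
deterministic (↓μ {y = y} d below) (↓μ {y = z} d′ below′) with <-cmp y z
... | tri< y<z _ _ with k , e ← below′ y<z = contradiction (deterministic d e) λ ()
... | tri≈ _ y≡z _ = y≡z
... | tri> _ _ z<y = contradiction d′ (suc-not-zero (below z<y))

deterministic* []       []         = refl
deterministic* (d ∷ ds) (d′ ∷ ds′) =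
  cong₂ _∷_ (deterministic d d′) (deterministic* ds ds′)

suc-not-zero (k , d) d′ = contradiction (deterministic d d′) λ ()

-- Recursive and recursively enumerable relations

least-root : ∀ (f : ℕ → ℕ) n → f n ≡ 0 →
             ∃ λ y → f y ≡ 0 × (∀ {i} → i < y → ∃ λ k → f i ≡ suc k)
least-root f n fn≡0 with f 0 in f0
least-root f n       fn≡0 | zero = 0 , f0 , λ ()
least-root f zero    fn≡0 | suc k = contradiction (trans (sym f0) fn≡0) λ ()
least-root f (suc n) fn≡0 | suc k
  with y , fy≡0 , below ← least-root (f ∘ suc) n fn≡0 =
  suc y , fy≡0 , λ { {zero} _ → k , f0 ; {suc i} (s≤s i<y) → below i<y }

-- A projection of a decidable set is the domain of a minimisation. Any root bounds the search for
-- the least one; conversely, determinism turns the evaluation to 0 inside `↓μ` into an equation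
-- about `fun`.
μ-defined : ∀ {n} (φ : TotalRec (suc n)) xs →
            (∃ λ w → φ .fun (w ∷ xs) ≡ 0) Bundles.⇔ (∃ λ z → μ (φ .prog) [ xs ]↓ z)
μ-defined φ xs = Bundles.mk⇔
  (λ (w , φw≡0) →
    let y , φy≡0 , below = least-root (λ i → φ .fun (i ∷ xs)) w φw≡0 in
    y , ↓μ (↓-respects-≡ φy≡0 (φ .total _))
           (λ i<y → let k , eq = below i<y in
                    k , ↓-respects-≡ eq (φ .total _)))
  (λ { (z , ↓μ d _) → z , deterministic (φ .total _) d })

kernel : TotalRec 1 → Rel ℕ 0ℓ
kernel c = _≡_ on λ x → c .fun (x ∷ [])

kernel-recursive : (c : TotalRec 1) → Recursive (kernel c)
kernel-recursive c = χ .prog , λ x y → decide (χ .total (x ∷ y ∷ []))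
  where
  χ : TotalRec 2
  -- This is 1 at distance 0 and 0 at every positive distance.
  χ = lit 1 ∸ᵣ ∣ c ⟨$⟩ (var 0F ∷ []) -ᵣ c ⟨$⟩ (var 1F ∷ []) ∣

  decide : ∀ {a b p xs} → p [ xs ]↓ 1 ∸ ∣ a - b ∣ →
           (a ≡ b × p [ xs ]↓ 1) ⊎ (a ≢ b × p [ xs ]↓ 0)
  decide {a} {b} d with ∣ a - b ∣ in eq
  ... | zero  = inj₁ (∣m-n∣≡0⇒m≡n eq , d)
  ... | suc k = inj₂ ((λ a≡b → 0≢1+n (trans (sym (m≡n⇒∣m-n∣≡0 a≡b)) eq)) ,
                      ↓-respects-≡ (0∸n≡0 k) d)

-- Coding the two intermediate points by one number turns FGF into the domain
-- of a single minimisation.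
kernels-composition-re : (f g : TotalRec 1) →
  RecursivelyEnumerable (kernel f ⨾ kernel g ⨾ kernel f)
kernels-composition-re f g = μ (φ .prog) , λ x y →
  Bundles.mk⇔ (Bundles.Equivalence.to (μ-defined φ _) ∘ root)
              (unroot ∘ Bundles.Equivalence.from (μ-defined φ _))
  where
  infix 7 _at_
  _at_ : TotalRec 1 → TotalRec 3 → TotalRec 3
  h at a = h ⟨$⟩ (a ∷ [])

  p q : TotalRec 3
  p = π₁ᵣ (var 0F)
  q = π₂ᵣ (var 0F)

  φ : TotalRec 3
  -- A sum of distances vanishes exactly when the labels match along the path `x`, `p`, `q`, `y`.
  φ = ∣ f at var 1F -ᵣ f at p ∣ +ᵣ
      (∣ g at p -ᵣ g at q ∣ +ᵣ ∣ f at q -ᵣ f at var 2F ∣)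

  root : ∀ {x y} → (kernel f ⨾ kernel g ⨾ kernel f) x y →
         ∃ λ w → φ .fun (w ∷ x ∷ y ∷ []) ≡ 0
  root {x} {y} (a , Fxa , b , Gab , Fby) = ⟨ a , b ⟩ , φ≡0
    where
    φ≡0 : φ .fun (⟨ a , b ⟩ ∷ x ∷ y ∷ []) ≡ 0
    φ≡0 rewrite π₁-⟨,⟩ a b | π₂-⟨,⟩ a b
              | m≡n⇒∣m-n∣≡0 Fxa | m≡n⇒∣m-n∣≡0 Gab | m≡n⇒∣m-n∣≡0 Fby = refl

  unroot : ∀ {x y} → (∃ λ w → φ .fun (w ∷ x ∷ y ∷ []) ≡ 0) →
           (kernel f ⨾ kernel g ⨾ kernel f) x y
  unroot {x} {y} (w , eq) =
    π₁ w , ∣m-n∣≡0⇒m≡n (m+n≡0⇒m≡0 _ eq) ,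
    π₂ w , ∣m-n∣≡0⇒m≡n (m+n≡0⇒m≡0 _ eq′) ,
    ∣m-n∣≡0⇒m≡n (m+n≡0⇒n≡0 ∣ gp - gq ∣ eq′)
    where
    gp = g .fun (π₁ w ∷ [])
    gq = g .fun (π₂ w ∷ [])
    eq′ = m+n≡0⇒n≡0 ∣ f .fun (x ∷ []) - f .fun (π₁ w ∷ []) ∣ eq

-- Finiteness under double negation

¬¬-subset-finite : ∀ {P : Pred ℕ 0ℓ} xs → (∀ {y} → P y → y ∈ xs) → ¬ ¬ Finite P
¬¬-subset-finite {P} xs P⊆xs ¬fin =
  sift xs λ (ys , eq) → ¬fin (ys , (λ Py → proj₁ (eq _) (P⊆xs Py) Py) , proj₂ (eq _))
  where
  sift : ∀ xs → ¬ ¬ ∃ λ ys → ∀ y → (y ∈ xs → P y → y ∈ ys) × (y ∈ ys → P y)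
  sift []       k = k ([] , λ y → (λ ()) , λ ())
  -- The goal is negative, so `P` may be decided at each of the finitely many candidates.
  sift (x ∷ xs) k = sift xs λ (ys , eq) → ¬¬-excluded-middle λ where
    (yes Px) → k (x ∷ ys , λ y →
      (λ { (here refl)  _  → here refl
         ; (there y∈xs) Py → there (proj₁ (eq y) y∈xs Py) }) ,
      (λ { (here refl) → Px ; (there y∈ys) → proj₂ (eq y) y∈ys }))
    (no ¬Px) → k (ys , λ y →
      (λ { (here refl)  Py → contradiction Py ¬Px
         ; (there y∈xs) Py → proj₁ (eq y) y∈xs Py }) ,
      proj₂ (eq y))

-- An explicit description of the join

⟨,⟩-injective : ∀ {a b c d} → ⟨ a , b ⟩ ≡ ⟨ c , d ⟩ → a ≡ c × b ≡ d
⟨,⟩-injective {a} {b} {c} {d} eq =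
  trans (sym (π₁-⟨,⟩ a b)) (trans (cong π₁ eq) (π₁-⟨,⟩ c d)) ,
  trans (sym (π₂-⟨,⟩ a b)) (trans (cong π₂ eq) (π₂-⟨,⟩ c d))

-- Such a `k` is the base row `⟨ e , 0 ⟩` of a program `e` that outputs 0 on its own code.
Hit : ℕ → Set
Hit k = ∃ λ w → pending w ≡ 0 × collapse w ≡ k

-- A closed form of `F ∨ G`: the rows have the same collapse, and the columns agree, up to
-- exchanging 0 and 1 if a hit row lies over that collapse.
record Join (x y : ℕ) : Set where
  constructor mkJoin
  field
    collapse≡ : collapse (π₁ x) ≡ collapse (π₁ y)
    second    : π₂ x ≡ π₂ y ⊎ (pred (π₂ x) ≡ pred (π₂ y) × Hit (collapse (π₁ x)))

Join-trans : ∀ {x y z} → Join x y → Join y z → Join x z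
Join-trans {x} {y} {z} (mkJoin c s) (mkJoin c′ s′) = mkJoin (trans c c′) (second s s′)
  where
  second : _ → _ →
           π₂ x ≡ π₂ z ⊎ (pred (π₂ x) ≡ pred (π₂ z) × Hit (collapse (π₁ x)))
  second (inj₁ eq)       (inj₁ eq′)       = inj₁ (trans eq eq′)
  second (inj₁ eq)       (inj₂ (eq′ , h)) =
    -- The hit is found over the row of `y` and carried back to that of `x`.
    inj₂ (trans (cong pred eq) eq′ , subst Hit (sym c) h)
  second (inj₂ (eq , h)) (inj₁ eq′)       = inj₂ (trans eq (cong pred eq′) , h)
  second (inj₂ (eq , h)) (inj₂ (eq′ , _)) = inj₂ (trans eq eq′ , h)

F⇒Join : F ⇒ Join
F⇒Join eq with c , s ← ⟨,⟩-injective eq = mkJoin c (inj₁ s)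

G⇒Join : G ⇒ Join
G⇒Join {x} {y} eq with c , s ← ⟨,⟩-injective eq =
  mkJoin (cong collapse c) (second (pending (π₁ x)) refl
    (trans s (cong (λ u → ifZero (pending u) (pred (π₂ y)) (π₂ y)) (sym c))))
  where
  second : ∀ k → pending (π₁ x) ≡ k →
           ifZero k (pred (π₂ x)) (π₂ x) ≡ ifZero k (pred (π₂ y)) (π₂ y) →
           π₂ x ≡ π₂ y ⊎ (pred (π₂ x) ≡ pred (π₂ y) × Hit (collapse (π₁ x)))
  second zero    p s = inj₂ (s , π₁ x , p , refl)
  second (suc _) p s = inj₁ s

∨⇒Join : F ∨ G ⇒ Join
∨⇒Join [ inj₁ Fxy ]    = F⇒Join Fxy
∨⇒Join [ inj₂ Gxy ]    = G⇒Join Gxy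
∨⇒Join (inj₁ Fxy ∷ yz) = Join-trans (F⇒Join Fxy) (∨⇒Join yz)
∨⇒Join (inj₂ Gxy ∷ yz) = Join-trans (G⇒Join Gxy) (∨⇒Join yz)

-- `F` moves to the hit row `w`, `G` changes the column there, and `F` moves back. If the columns
-- already agree, a single `F` step suffices, padded by reflexivity.
Join⇒FGF : Join ⇒ F ⨾ G ⨾ F
Join⇒FGF (mkJoin c (inj₁ s)) = _ , refl , _ , refl , cong₂ ⟨_,_⟩ c s
Join⇒FGF {x} {y} (mkJoin c (inj₂ (s , w , p , h))) =
  ⟨ w , π₂ x ⟩ , Fxa , ⟨ w , π₂ y ⟩ , Gab , Fby
  where
  Fxa : F x ⟨ w , π₂ x ⟩
  Fxa rewrite π₁-⟨,⟩ w (π₂ x) | π₂-⟨,⟩ w (π₂ x) | h = refl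
  Gab : G ⟨ w , π₂ x ⟩ ⟨ w , π₂ y ⟩
  Gab rewrite π₁-⟨,⟩ w (π₂ x) | π₂-⟨,⟩ w (π₂ x)
            | π₁-⟨,⟩ w (π₂ y) | π₂-⟨,⟩ w (π₂ y) | p = cong ⟨ w ,_⟩ s
  Fby : F ⟨ w , π₂ y ⟩ y
  Fby rewrite π₁-⟨,⟩ w (π₂ y) | π₂-⟨,⟩ w (π₂ y) | h | c = refl

FGF⇒∨ : F ⨾ G ⨾ F ⇒ F ∨ G
FGF⇒∨ (a , Fxa , b , Gab , Fby) = inj₁ Fxa ∷ inj₂ Gab ∷ [ inj₁ Fby ]

-- Finiteness of the classes

-- A row that is no hit is its own collapse, hence equals `k`; two hits over `k` share their program
-- and coincide by `pending-unique`. The double negation allows a case split on `Hit k`.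
collapse-fibre : ∀ {k} → ¬ ¬ ∃ λ vs → ∀ {v} → collapse v ≡ k → v ∈ vs
collapse-fibre {k} ¬fibre = ¬¬-excluded-middle {A = Hit k} λ where
    (yes hit) → ¬fibre (k ∷ proj₁ hit ∷ [] , λ {v} → with-hit hit (pending v) refl)
    (no ¬hit) → ¬fibre (k ∷ [] , λ {v} → without-hit ¬hit (pending v) refl)
  where
  with-hit : ((w , _) : Hit k) → ∀ {v} n → pending v ≡ n → collapse v ≡ k →
             v ∈ k ∷ w ∷ []
  with-hit (w , pw , cw) {v} zero pv cv = there (here (pending-unique pv pw π₁v≡π₁w))
    where
    π₁v≡π₁w : π₁ v ≡ π₁ w
    π₁v≡π₁w with cv′ ← trans cv (sym cw) rewrite pv | pw = proj₁ (⟨,⟩-injective cv′)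
  with-hit _ (suc _) pv cv rewrite pv = here cv

  without-hit : ¬ Hit k → ∀ {v} n → pending v ≡ n → collapse v ≡ k → v ∈ k ∷ []
  without-hit ¬hit zero    pv cv = contradiction (_ , pv , cv) ¬hit
  without-hit ¬hit (suc _) pv cv rewrite pv = here cv

pred-fibre : ∀ {m n} → pred m ≡ pred n → n ∈ m ∷ 0 ∷ 1 ∷ []
pred-fibre {_}     {zero}        _  = there (here refl)
pred-fibre {_}     {suc zero}    _  = there (there (here refl))
pred-fibre {suc m} {suc (suc n)} eq = here (cong suc (sym eq))

-- A class lies in a product: rows from one fibre of `collapse`, columns among `π₂ x`, 0 and 1.
∨-FC : FC (F ∨ G)
∨-FC x ¬fin = collapse-fibre {collapse (π₁ x)} λ (us , fibre) →
  ¬¬-subset-finite (cartesianProductWith ⟨_,_⟩ us (π₂ x ∷ 0 ∷ 1 ∷ []))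
    (λ {y} xy → subst (_∈ _) (⟨π₁,π₂⟩ y)
      (∈-cartesianProductWith⁺ ⟨_,_⟩
        (fibre (sym (Join.collapse≡ (∨⇒Join xy))))
        (seconds (Join.second (∨⇒Join xy)))))
    ¬fin
  where
  seconds : ∀ {m n} {A : Set} → m ≡ n ⊎ (pred m ≡ pred n × A) → n ∈ m ∷ 0 ∷ 1 ∷ []
  seconds (inj₁ refl)     = here refl
  seconds (inj₂ (eq , _)) = pred-fibre eq

-- Undecidability by diagonalisation

point : ℕ → ℕ → ℕ
point e i = ⟨ ⟨ e , 0 ⟩ , i ⟩

-- Even when time 0 is itself a hit, the row is sent to `⟨ e , 0 ⟩`, which is the row itself.
collapse-⟨,0⟩ : ∀ e → collapse ⟨ e , 0 ⟩ ≡ ⟨ e , 0 ⟩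
collapse-⟨,0⟩ e with pending ⟨ e , 0 ⟩
... | zero  = cong ⟨_, 0 ⟩ (π₁-⟨,⟩ e 0)
... | suc _ = refl

∨⇔outputs-0 : ∀ e → (F ∨ G) (point e 0) (point e 1) Bundles.⇔
                    (∃ λ t → run t e ≡ output 0)
∨⇔outputs-0 e = Bundles.mk⇔ (to ∘ Join.second ∘ ∨⇒Join) (FGF⇒∨ ∘ Join⇒FGF ∘ from)
  where
  base : collapse (π₁ (point e 0)) ≡ ⟨ e , 0 ⟩
  base = trans (cong collapse (π₁-⟨,⟩ _ 0)) (collapse-⟨,0⟩ e)

  to : _ → ∃ λ t → run t e ≡ output 0
  to (inj₁ eq) = contradiction (trans (sym (π₂-⟨,⟩ _ 0)) (trans eq (π₂-⟨,⟩ _ 1))) λ ()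
  to (inj₂ (_ , w , pw , cw)) =
    π₂ w , trans (cong (run (π₂ w)) (sym π₁w≡e)) (∣m-n∣≡0⇒m≡n pw)
    where
    π₁w≡e : π₁ w ≡ e
    π₁w≡e = proj₁ (⟨,⟩-injective
      (trans (sym (cong (λ k → ifZero k ⟨ π₁ w , 0 ⟩ w) pw)) (trans cw base)))

  from : (∃ λ t → run t e ≡ output 0) → Join (point e 0) (point e 1)
  from (t , eq) = mkJoin (cong collapse (trans (π₁-⟨,⟩ _ 0) (sym (π₁-⟨,⟩ _ 1))))
    (inj₂ (trans (cong pred (π₂-⟨,⟩ _ 0)) (sym (cong pred (π₂-⟨,⟩ _ 1))) ,
           ⟨ e , t ⟩ , pw ,
           trans (cong (λ k → ifZero k ⟨ π₁ ⟨ e , t ⟩ , 0 ⟩ ⟨ e , t ⟩) pw)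
             (trans (cong ⟨_, 0 ⟩ (π₁-⟨,⟩ e t)) (sym base))))
    where
    pw : pending ⟨ e , t ⟩ ≡ 0
    pw = m≡n⇒∣m-n∣≡0 (trans (cong₂ run (π₂-⟨,⟩ e t) (π₁-⟨,⟩ e t)) eq)

∨-not-recursive : ¬ Recursive (F ∨ G)
∨-not-recursive (χ , decides) = refute (decides (point e 0) (point e 1))
  where
  pointᵣ : ℕ → TotalRec 1
  pointᵣ i = ⟨ ⟨ var 0F , lit 0 ⟩ᵣ , lit i ⟩ᵣ

  d : PartialRec 1
  d = comp χ (pointᵣ 0 .prog ∷ pointᵣ 1 .prog ∷ [])

  e : ℕ
  e = ⌜ d ⌝

  run-χ : ∀ {z} → χ [ point e 0 ∷ point e 1 ∷ [] ]↓ z → ∃ λ t → run t e ≡ output z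
  run-χ χ↓ = run-output (↓comp (pointᵣ 0 .total _ ∷ pointᵣ 1 .total _ ∷ []) χ↓)

  Related : Set
  Related = (F ∨ G) (point e 0) (point e 1)

  refute : (Related × χ [ point e 0 ∷ point e 1 ∷ [] ]↓ 1) ⊎
           (¬ Related × χ [ point e 0 ∷ point e 1 ∷ [] ]↓ 0) → ⊥
  refute (inj₁ (related , χ↓1))
    with t  , eq  ← Bundles.Equivalence.to (∨⇔outputs-0 e) related
       | t′ , eq′ ← run-χ χ↓1
    -- The outputs 0 and 1 would have to appear at the same time.
    with refl ← output-once {e} {m = t} {t′} (λ ()) (λ ()) eq eq′ =
    0≢1+n (output-injective (trans (sym eq) eq′))
  -- The answer 0 is itself an output 0 of `d` on its own code, which relates the two points.
  refute (inj₂ (unrelated , χ↓0)) =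
    unrelated (Bundles.Equivalence.from (∨⇔outputs-0 e) (run-χ χ↓0))

-- Assembly of the properties

∨-isEquivalence : IsEquivalence (F ∨ G)
∨-isEquivalence = record
  { refl  = [ inj₁ refl ]
  ; sym   = symmetric _ λ { (inj₁ Fxy) → inj₁ (sym Fxy)
                          ; (inj₂ Gxy) → inj₂ (sym Gxy) }
  ; trans = transitive _
  }

re-respects-⇔ : ∀ {R S : Rel ℕ 0ℓ} → R ⇔ S →
                RecursivelyEnumerable R → RecursivelyEnumerable S
re-respects-⇔ (R⇒S , S⇒R) (p , spec) = p , λ x y →
  Bundles.mk⇔ (Bundles.Equivalence.to (spec x y) ∘ S⇒R)
              (R⇒S ∘ Bundles.Equivalence.from (spec x y))

proposition5 : ∃₂ λ (F G : Rel ℕ 0ℓ) →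
    IsEquivalence F × Recursive F ×
    IsEquivalence G × Recursive G ×
    IsEquivalence (F ∨ G) ×
    RecursivelyEnumerable (F ∨ G) ×
    FC (F ∨ G) ×
    ¬ Recursive (F ∨ G) ×
    ((F ∨ G) ⇔ (F ⨾ G ⨾ F))
proposition5 =
  F , G ,
  On.isEquivalence labelF isEquivalence , kernel-recursive labelFᵣ ,
  On.isEquivalence labelG isEquivalence , kernel-recursive labelGᵣ ,
  ∨-isEquivalence ,
  -- Semi-decidability is read off `FGF`, where the search is for two intermediate points instead of
  -- a path of unknown length.
  re-respects-⇔ (FGF⇒∨ , Join⇒FGF ∘ ∨⇒Join) (kernels-composition-re labelFᵣ labelGᵣ) ,
  ∨-FC , ∨-not-recursive ,
  (Join⇒FGF ∘ ∨⇒Join , FGF⇒∨)
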